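{- Let $n,m\ge 0$ be integers with $2n+m\ge 1$ and $(n,m)\neq(0,1)$. Let $G$ be a simple graph with $\chi_{n,m}(G)=k$. Then $$\mathrm{arb}(G)\le \left\lceil \log_{2n+m} k+\frac{k}{2}\right\rceil .$$
   Context: All graphs are finite. An $(n,m)$-graph $G$ is a graph with $n$ types of arcs (labeled $2,4,\ldots,2n$) and $m$ types of edges (labeled $2n+1,\ldots,2n+m$), whose underlying undirected graph $\mathrm{und}(G)$ is simple (so each adjacent pair of distinct vertices is joined by exactly one arc or exactly one edge, with exactly one type, and there are no loops). A homomorphism of an $(n,m)$-graph $G$ to an $(n,m)$-graph $H$ is a map $f:V(G)\to V(H)$ such that whenever $uv$ is an arc from $u$ to $v$ (resp. an edge) of type $\alpha$ in $G$, $f(u)f(v)$ is an arc from $f(u)$ to $f(v)$ (resp. an edge) of type $\alpha$ in $H$; write $G\to H$ if one exists. For an $(n,m)$-graph $G$, $\chi_{n,m}(G)=\min\{|V(H)|: H \text{ an } (n,m)\text{ -graph},\ G\to H\}$. For a simple graph $S$, $\chi_{n,m}(S)=\max\{\chi_{n,m}(G): G \text{ an } (n,m)\text{ -graph with } \mathrm{und}(G)=S\}$. The arboricity $\mathrm{arb}(G)$ of a graph $G$ is the minimum $r$ such that the edge set of $G$ can be decomposed into $r$ forests. -}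

module Defs where

open import Data.Bool using (Bool; T; false)
open import Data.Fin using (Fin; zero; suc; inject₁; fromℕ)
open import Data.Integer as ℤ using (ℤ; +_; -[1+_])
open import Data.Maybe as Maybe using (Maybe; just; nothing; is-just)
open import Data.Nat using (ℕ; suc; _+_; _*_; _^_; _≤_)
open import Data.Product using (Σ; ∃; ∃!; _×_)
open import Data.Rational.Unnormalised as ℚᵘ using (ℚᵘ; mkℚᵘ)
open import Function.Definitions using (Injective)
open import Relation.Binary.PropositionalEquality
  using (_≡_; refl; sym; cong; trans)
open import Relation.Nullary using (¬_)

IsLeast : (ℕ → Set) → ℕ → Set
IsLeast P k = P k × (∀ j → P j → k ≤ j)

IsGreatest : (ℕ → Set) → ℕ → Set
IsGreatest P k = P k × (∀ j → P j → j ≤ k)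

record SimpleGraph (v : ℕ) : Set where
  field
    adj        : Fin v → Fin v → Bool
    adj-sym    : ∀ x y → adj x y ≡ adj y x
    adj-irrefl : ∀ x → adj x x ≡ false

  Adj : Fin v → Fin v → Set
  Adj x y = T (adj x y)

open SimpleGraph using (adj; Adj)

-- How an ordered pair (x , y) of adjacent vertices is joined: by an arc from
-- x to y, by an arc from y to x, or by an edge.  The arc type i : Fin n is the
-- label 2(i+1), and the edge type j : Fin m is the label 2n+1+j.
data Link (n m : ℕ) : Set where
  arc⇒ : Fin n → Link n m
  arc⇐ : Fin n → Link n m
  edge : Fin m → Link n m

reverse : ∀ {n m} → Link n m → Link n m
reverse (arc⇒ i) = arc⇐ i
reverse (arc⇐ i) = arc⇒ i
reverse (edge j) = edge j

-- Since link is a function, an adjacent pair carries exactly one arc or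
-- exactly one edge, of exactly one type.
record NMGraph (n m v : ℕ) : Set where
  field
    link         : Fin v → Fin v → Maybe (Link n m)
    link-reverse : ∀ x y → link y x ≡ Maybe.map reverse (link x y)
    link-irrefl  : ∀ x → link x x ≡ nothing

  Arc : Fin n → Fin v → Fin v → Set
  Arc i x y = link x y ≡ just (arc⇒ i)

  Edge : Fin m → Fin v → Fin v → Set
  Edge j x y = link x y ≡ just (edge j)

und : ∀ {n m v} → NMGraph n m v → SimpleGraph v
und G = record
  { adj        = λ x y → is-just (link x y)
  ; adj-sym    = λ x y →
      trans (is-just-map (link x y)) (cong is-just (sym (link-reverse x y)))
  ; adj-irrefl = λ x → cong is-just (link-irrefl x)
  }
  where
  open NMGraph G
  is-just-map : ∀ z → is-just z ≡ is-just (Maybe.map reverse z)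
  is-just-map (just _) = refl
  is-just-map nothing  = refl

-- Equality of simple graphs on the same vertex set.
_≐_ : ∀ {v} → SimpleGraph v → SimpleGraph v → Set
G ≐ H = ∀ x y → adj G x y ≡ adj H x y

record IsHom {n m v w} (G : NMGraph n m v) (H : NMGraph n m w)
             (f : Fin v → Fin w) : Set where
  private
    module G = NMGraph G
    module H = NMGraph H
  field
    arc-pres  : ∀ i x y → G.Arc i x y → H.Arc i (f x) (f y)
    edge-pres : ∀ j x y → G.Edge j x y → H.Edge j (f x) (f y)

_⟶_ : ∀ {n m v w} → NMGraph n m v → NMGraph n m w → Set
G ⟶ H = ∃ λ f → IsHom G H f

-- χ_{n,m}(G) = k for an (n,m)-graph G.
IsChromaticNumber : ∀ {n m v} → NMGraph n m v → ℕ → Set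
IsChromaticNumber {n} {m} G =
  IsLeast (λ h → Σ (NMGraph n m h) λ H → G ⟶ H)

-- χ_{n,m}(S) = k for a simple graph S.
IsSimpleChromaticNumber : ∀ (n m : ℕ) {v} → SimpleGraph v → ℕ → Set
IsSimpleChromaticNumber n m {v} S =
  IsGreatest (λ k → Σ (NMGraph n m v) λ G → und G ≐ S × IsChromaticNumber G k)

-- Cycles have length 3 + ℓ, so ℓ ranges over all of ℕ.
record IsCycle {v} (G : SimpleGraph v) (ℓ : ℕ) (c : Fin (3 + ℓ) → Fin v) : Set where
  field
    distinct : Injective _≡_ _≡_ c
    step     : ∀ i → Adj G (c (inject₁ i)) (c (suc i))
    close    : Adj G (c (fromℕ (2 + ℓ))) (c zero)

IsForest : ∀ {v} → SimpleGraph v → Set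
IsForest G = ∀ ℓ c → ¬ IsCycle G ℓ c

record IsForestDecomposition {v} (G : SimpleGraph v) (r : ℕ)
                             (F : Fin r → SimpleGraph v) : Set where
  field
    forests   : ∀ i → IsForest (F i)
    subgraphs : ∀ i x y → Adj (F i) x y → Adj G x y
    partition : ∀ x y → Adj G x y → ∃! _≡_ λ i → Adj (F i) x y

IsArboricity : ∀ {v} → SimpleGraph v → ℕ → Set
IsArboricity {v} G =
  IsLeast (λ r → Σ (Fin r → SimpleGraph v) λ F → IsForestDecomposition G r F)

-- A real number x given by its set of rational upper bounds { q | x ≤ q }.
UpperCut : Set₁
UpperCut = ℚᵘ → Set

-- log_b k for b ≥ 2: for q = a / d with d > 0, log_b k ≤ q means k ^ d ≤ b ^ a;
-- when a < 0 this is multiplied through by b ^ (- a).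
-- For k = 0 every rational is an upper bound, i.e. log_b 0 = -∞.
log : ℕ → ℕ → UpperCut
log b k (mkℚᵘ (+ a)    d-1) = k ^ suc d-1 ≤ b ^ a
log b k (mkℚᵘ -[1+ a ] d-1) = k ^ suc d-1 * b ^ suc a ≤ 1

infixl 6 _⊕_
_⊕_ : UpperCut → ℚᵘ → UpperCut
(x ⊕ p) q = x (q ℚᵘ.- p)

-- ⌈ x ⌉ = c: c is the least integer with x ≤ c.  (-∞ has no ceiling.)
IsCeiling : UpperCut → ℤ → Set
IsCeiling x c = x (c ℚᵘ./ 1) × (∀ c′ → x (c′ ℚᵘ./ 1) → c ℤ.≤ c′)

{-# OPTIONS --safe #-}

-- Let b = 2n + m ≥ 2.  For a vertex set W, every labelling of the edges of G[W]
-- is read off an (n,m)-graph on k vertices through a map W → k, whence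
-- b^|E(W)| ≤ k^|W| · b^(k(k-1)/2).  With 2c ≥ k + 2 log_b k this bounds |E(W)| by
-- c (|W| - 1), and Nash-Williams' theorem yields a decomposition of G into c
-- forests.  The conclusion is decidable, so classical reasoning is available
-- under a double negation.

module Submission where

open import Data.Bool using (true; false; if_then_else_; T)
open import Data.Bool.Properties using (∨-comm)
open import Data.Empty using (⊥; ⊥-elim)
open import Data.Fin as Fin using (Fin; zero; suc)
open import Data.Fin.Induction using (<-weakInduction)
import Data.Fin.Properties as Fin
open import Data.Integer as ℤ using (ℤ; +_; -[1+_])
import Data.Integer.Properties as ℤ
import Data.Integer.Tactic.RingSolver as ℤ
open import Data.List
  using (List; []; _∷_; length; filter; map; allFin; lookup; cartesianProduct)
open import Data.List.Properties
  using (length-map; filter-all; filter-reject; filter-≐)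
import Data.List.Membership.DecPropositional as DecMembership
open import Data.List.Membership.Propositional using (_∈_)
open import Data.List.Membership.Propositional.Properties
  using (∈-filter⁺; ∈-filter⁻; ∈-map⁺; ∈-allFin; ∈-lookup; ∈-cartesianProduct⁺)
open import Data.List.Relation.Unary.All as All using (_∷_)
open import Data.List.Relation.Unary.AllPairs using (_∷_)
open import Data.List.Relation.Unary.Any using (here; there; index)
open import Data.List.Relation.Unary.Any.Properties using (lookup-index)
open import Data.List.Relation.Unary.Unique.Propositional using (Unique)
import Data.List.Relation.Unary.Unique.Propositional.Properties as Unique
open import Data.Maybe as Maybe using (Maybe; just; nothing; fromMaybe)
open import Data.Nat as ℕ
  using (ℕ; zero; suc; _+_; _*_; _^_; _≤_; _<_; z≤n; s≤s; _≤′_; ≤′-refl; ≤′-step)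
open import Data.Nat.Induction using (<-rec)
import Data.Nat.Properties as ℕ
open import Data.Nat.Tactic.RingSolver using (solve-∀)
open import Data.Product as Prod
  using (Σ; ∃; ∃!; _×_; _,_; proj₁; proj₂; uncurry)
open import Data.Product.Properties using (≡-dec)
open import Data.Rational.Unnormalised as ℚᵘ using (ℚᵘ)
open import Data.Sum as Sum using (_⊎_; inj₁; inj₂)
open import Data.Sum.Function.Propositional using (_⊎-↔_)
open import Effect.Monad using (RawMonad)
open import Function using (_∘_; id)
open import Function.Bundles using (_↔_; mk↔ₛ′; Inverse)
open import Function.Construct.Composition using (_↔-∘_)
open import Function.Construct.Identity using (↔-id)
open import Function.Definitions using (Injective)
open import Level using (0ℓ)
open import Relation.Binary using (Rel; DecidableEquality; IsEquivalence)
open import Relation.Binary.Construct.Closure.Equivalence as EC using (EqClosure)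
open import Relation.Binary.Construct.Closure.ReflexiveTransitive using (ε; _◅_; _◅◅_)
open import Relation.Binary.Construct.Closure.Symmetric using (fwd; bwd)
open import Relation.Binary.Definitions using (tri<; tri≈; tri>)
open import Relation.Binary.PropositionalEquality
  using (_≡_; _≢_; refl; sym; trans; cong; cong₂; subst)
open import Relation.Nullary
  using (¬_; Dec; yes; no; does; contradiction; ¬?; _×-dec_; _⊎-dec_; T?)
open import Relation.Nullary.Decidable
  using (decidable-stable; ¬¬-excluded-middle; dec-false)
open import Relation.Nullary.Negation using (¬¬-Monad; ¬¬-map)
open import Relation.Unary using (Pred; Decidable; _⊆_; _∩_)
open import Defs

open SimpleGraph using (adj; Adj; adj-sym; adj-irrefl)
open NMGraph using (link; link-reverse; link-irrefl)

-- Connectivity and forests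

-- The obstacle is one vertex: the count bounds |E(W)| through |W|, whereas a union of `c` forests
-- needs |W| - 1. With d = 2c - k the count overshoots by a surplus d + k(k-1) that does not depend
-- on W, so it is of use only once |W| is large compared with `c`; a small W is sparse already
-- because it has so few pairs. Two choices keep the count sharp enough. A vertex map is recorded on
-- W alone, so that the number of maps depends on |W| and not on the order of G, and a target is
-- recorded only by its links between pairs x < y. Connectivity is the equivalence closure of an
-- edge set, and no simple paths are formed. In a forest, the path between two vertices is recovered
-- as the set of edges whose removal separates them.

¬¬-sequence : ∀ {n} {P : Fin n → Set} → (∀ i → ¬ ¬ P i) → ¬ ¬ (∀ i → P i)
¬¬-sequence = Fin.sequence (RawMonad.rawApplicative ¬¬-Monad)

Edge : ℕ → Set
Edge v = Fin v × Fin v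

EdgeSet : ℕ → Set₁
EdgeSet v = Pred (Edge v) 0ℓ

_≟ᴱ_ : ∀ {v} → DecidableEquality (Edge v)
_≟ᴱ_ = ≡-dec Fin._≟_ Fin._≟_

module _ {v : ℕ} where

  Conn : EdgeSet v → Rel (Fin v) 0ℓ
  Conn P = EqClosure (λ x y → P (x , y))

  Joined : EdgeSet v → Edge v → Set
  Joined P (x , y) = Conn P x y

  infixl 7 _∖_ _∪_

  _∖_ : EdgeSet v → Edge v → EdgeSet v
  (P ∖ e) f = P f × f ≢ e

  _∪_ : EdgeSet v → Edge v → EdgeSet v
  (P ∪ e) f = P f ⊎ f ≡ e

  Acyclic : EdgeSet v → Set
  Acyclic P = ∀ {f} → P f → ¬ Joined (P ∖ f) f

  Joins : Edge v → Rel (Fin v) 0ℓ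
  Joins f x y = f ≡ (x , y) ⊎ f ≡ (y , x)

  conn-sym : ∀ {P x y} → Conn P x y → Conn P y x
  conn-sym {P} = EC.symmetric (λ x y → P (x , y))

  conn-⊆ : ∀ {P Q x y} → P ⊆ Q → Conn P x y → Conn Q x y
  conn-⊆ P⊆Q = EC.map P⊆Q

  conn-edge : ∀ {P f x y} → P f → Joins f x y → Conn P x y
  conn-edge Pf (inj₁ refl) = fwd Pf ◅ ε
  conn-edge Pf (inj₂ refl) = bwd Pf ◅ ε

  -- A walk need cross the new edge at most once: two crossings in opposite directions cancel, and
  -- two in the same direction collapse to one.
  conn-∪ : ∀ {P a b x y} → Conn (P ∪ (a , b)) x y →
           Conn P x y ⊎ (Conn P x a × Conn P b y) ⊎ (Conn P x b × Conn P a y)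
  conn-∪ ε = inj₁ ε
  conn-∪ (s ◅ w) with s | conn-∪ w
  ... | fwd (inj₁ p)    | inj₁ q              = inj₁ (fwd p ◅ q)
  ... | fwd (inj₁ p)    | inj₂ (inj₁ (q , r)) = inj₂ (inj₁ (fwd p ◅ q , r))
  ... | fwd (inj₁ p)    | inj₂ (inj₂ (q , r)) = inj₂ (inj₂ (fwd p ◅ q , r))
  ... | fwd (inj₂ refl) | inj₁ q              = inj₂ (inj₁ (ε , q))
  ... | fwd (inj₂ refl) | inj₂ (inj₁ (q , r)) = inj₂ (inj₁ (ε , r))
  ... | fwd (inj₂ refl) | inj₂ (inj₂ (q , r)) = inj₁ r
  ... | bwd (inj₁ p)    | inj₁ q              = inj₁ (bwd p ◅ q)
  ... | bwd (inj₁ p)    | inj₂ (inj₁ (q , r)) = inj₂ (inj₁ (bwd p ◅ q , r))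
  ... | bwd (inj₁ p)    | inj₂ (inj₂ (q , r)) = inj₂ (inj₂ (bwd p ◅ q , r))
  ... | bwd (inj₂ refl) | inj₁ q              = inj₂ (inj₂ (ε , q))
  ... | bwd (inj₂ refl) | inj₂ (inj₁ (q , r)) = inj₁ r
  ... | bwd (inj₂ refl) | inj₂ (inj₂ (q , r)) = inj₂ (inj₂ (ε , r))

  acyclic-⊆ : ∀ {P Q} → Q ⊆ P → Acyclic P → Acyclic Q
  acyclic-⊆ Q⊆P acyclic Qf = acyclic (Q⊆P Qf) ∘ conn-⊆ (Prod.map₁ Q⊆P)

  -- A new cycle would have to use `f`; what remains of it without `f` is a walk in `P` between the
  -- ends of `f`, possibly through the old edge `g`.
  acyclic-∪ : ∀ {P f} → Acyclic P → ¬ Joined P f → Acyclic (P ∪ f)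
  acyclic-∪ {P} {f} acyclic sep {g} (inj₂ refl) w =
    sep (conn-⊆ (λ { (inj₁ p , _) → p ; (inj₂ q , ≢f) → contradiction q ≢f }) w)
  acyclic-∪ {P} {f} acyclic sep {g} (inj₁ Pg) w
    with conn-∪ (conn-⊆ {Q = (P ∖ g) ∪ f}
           (λ { (inj₁ p , ≢g) → inj₁ (p , ≢g) ; (inj₂ q , _) → inj₂ q }) w)
  ... | inj₁ g₁~g₂ = acyclic Pg g₁~g₂
  ... | inj₂ (inj₁ (g₁~a , b~g₂)) =
    sep (conn-sym (conn-⊆ proj₁ g₁~a) ◅◅ fwd Pg ◅ conn-sym (conn-⊆ proj₁ b~g₂))
  ... | inj₂ (inj₂ (g₁~b , a~g₂)) =
    sep (conn-⊆ proj₁ a~g₂ ◅◅ bwd Pg ◅ conn-⊆ proj₁ g₁~b)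

  -- In a forest these are the edges of the path from x to y.
  Separating : EdgeSet v → Fin v → Fin v → EdgeSet v
  Separating P x y f = P f × ¬ Conn (P ∖ f) x y

  conn-∪-joins : ∀ {P f x y s t} → Joins f x y → Conn (P ∪ f) s t →
    Conn P s t ⊎ (Conn P s x × Conn P y t) ⊎ (Conn P s y × Conn P x t)
  conn-∪-joins (inj₁ refl) w = conn-∪ w
  conn-∪-joins (inj₂ refl) w with conn-∪ w
  ... | inj₁ p        = inj₁ p
  ... | inj₂ (inj₁ p) = inj₂ (inj₂ p)
  ... | inj₂ (inj₂ p) = inj₂ (inj₁ p)

  acyclic-joins : ∀ {P f x y} → Acyclic P → P f → Joins f x y → ¬ Conn (P ∖ f) x y
  acyclic-joins acyclic Pf (inj₁ refl) = acyclic Pf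
  acyclic-joins acyclic Pf (inj₂ refl) = acyclic Pf ∘ conn-sym

  -- Prepending f to the path from z to y: either f is not on that path, or
  -- it is its first edge and the new path is what remains.
  separating-step : ∀ {P f x y z} → Acyclic P → P f → Joins f x z →
    Conn (Separating P z y) z y → ¬ ¬ Conn (Separating P x y) x y
  separating-step {P} {f} {x} {y} {z} acyclic Pf j w k =
    ¬¬-excluded-middle λ where
      (yes z~y) → k (conn-edge (Pf , λ x~y → x≁z (x~y ◅◅ conn-sym z~y)) j ◅◅
        conn-⊆ (λ { (Pg , z≁y) → Pg , λ x~y →
          z≁y (conn-sym (conn-edge (Pf , λ { refl → z≁y z~y }) j) ◅◅ x~y) }) w)
      (no z≁y) → case-no z≁y (conn-∪-joins j (conn-⊆ split w))
    where
    x≁z : ¬ Conn (P ∖ f) x z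
    x≁z = acyclic-joins acyclic Pf j

    split : Separating P z y ⊆ (Separating P z y ∖ f) ∪ f
    split {g} s with g ≟ᴱ f
    ... | yes g≡f = inj₂ g≡f
    ... | no  g≢f = inj₁ (s , g≢f)

    forget : Separating P z y ∖ f ⊆ P ∖ f
    forget ((Pg , _) , g≢f) = Pg , g≢f

    case-no : ¬ Conn (P ∖ f) z y → let Q = Separating P z y ∖ f in
      Conn Q z y ⊎ (Conn Q z x × Conn Q z y) ⊎ (Conn Q z z × Conn Q x y) → ⊥
    case-no z≁y (inj₁ q)              = z≁y (conn-⊆ forget q)
    case-no z≁y (inj₂ (inj₁ (_ , q))) = z≁y (conn-⊆ forget q)
    case-no z≁y (inj₂ (inj₂ (_ , q))) = k (conn-⊆
      (λ { ((Pg , z≁y′) , g≢f) → Pg , λ x~y →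
           z≁y′ (conn-sym (conn-edge (Pf , g≢f ∘ sym) j) ◅◅ x~y) }) q)

  -- Replaces the choice of a simple path: each edge of the resulting walk may be exchanged, since
  -- deleting it alone cuts `x` from `y`.
  conn-separating : ∀ {P x y} → Acyclic P → Conn P x y →
                    ¬ ¬ Conn (Separating P x y) x y
  conn-separating acyclic ε k = k ε
  conn-separating acyclic (fwd p ◅ w) k = conn-separating acyclic w λ w′ →
    separating-step acyclic p (inj₁ refl) w′ k
  conn-separating acyclic (bwd p ◅ w) k = conn-separating acyclic w λ w′ →
    separating-step acyclic p (inj₂ refl) w′ k

  ¬¬-conn-isEquivalence : ∀ P → IsEquivalence (λ x y → ¬ ¬ Conn P x y)
  ¬¬-conn-isEquivalence P = record
    { refl  = λ k → k ε
    ; sym   = ¬¬-map conn-sym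
    ; trans = λ p q k → p λ p′ → q λ q′ → k (p′ ◅◅ q′)
    }

  -- Since `S` is closed under `Q` in both directions, a walk that starts in `S` never leaves it,
  -- and each edge it uses has both ends in `S`.
  conn-within : ∀ {P Q R : EdgeSet v} {S : Pred (Fin v) 0ℓ} →
    (∀ {x y} → Q (x , y) → S x → S y) → (∀ {x y} → Q (x , y) → S y → S x) →
    (∀ {x y} → (P ∩ Q) (x , y) → S x → S y → R (x , y)) →
    ∀ {x y} → S x → Conn (P ∩ Q) x y → Conn R x y
  conn-within sr sl into Sx ε = ε
  conn-within sr sl into Sx (fwd p ◅ w) = let Sy = sr (proj₂ p) Sx in
    fwd (into p Sx Sy) ◅ conn-within sr sl into Sy w
  conn-within sr sl into Sx (bwd p ◅ w) = let Sy = sl (proj₂ p) Sx in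
    bwd (into p Sy Sx) ◅ conn-within sr sl into Sy w

-- Contracting the first edge (a , b) of the list identifies a with b.
length≤1+edges : ∀ {v} (L : List (Edge v)) (W : List (Fin v)) → Unique W →
  (∀ {x y} → x ∈ W → y ∈ W → ¬ ¬ Conn (_∈ L) x y) → length W ≤ suc (length L)
length≤1+edges {v} L = go (length L) L refl
  where
  go : ∀ n (L : List (Edge v)) → length L ≡ n → (W : List (Fin v)) → Unique W →
    (∀ {x y} → x ∈ W → y ∈ W → ¬ ¬ Conn (_∈ L) x y) → length W ≤ suc n
  go zero [] _ [] _ _ = z≤n
  go zero [] _ (x ∷ []) _ _ = s≤s z≤n
  go zero [] _ (x ∷ y ∷ W) ((x≢y ∷ _) ∷ _) conn =
    ⊥-elim (conn (here refl) (there (here refl)) λ { ε → x≢y refl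
                                                   ; (fwd () ◅ _)
                                                   ; (bwd () ◅ _) })
  go (suc n) ((a , b) ∷ L) eq W unique conn =
    ℕ.≤-trans (length-remove W unique) (s≤s
      (go n L′ (trans (length-map _ L) (ℕ.suc-injective eq))
          W′ (Unique.filter⁺ ≢a? unique) conn′))
    where
    ≢a? : ∀ x → Dec (x ≢ a)
    ≢a? x = ¬? (x Fin.≟ a)

    φ : Fin v → Fin v
    φ x with x Fin.≟ a
    ... | yes _ = b
    ... | no  _ = x

    φ-fixes : ∀ {x} → x ≢ a → φ x ≡ x
    φ-fixes {x} x≢a with x Fin.≟ a
    ... | yes x≡a = contradiction x≡a x≢a
    ... | no  _   = refl

    φa≡φb : φ a ≡ φ b
    φa≡φb with a Fin.≟ a | b Fin.≟ a
    ... | yes _  | yes _ = refl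
    ... | yes _  | no  _ = refl
    ... | no a≢a | _     = contradiction refl a≢a

    W′ = filter ≢a? W
    L′ = map (Prod.map φ φ) L

    contract : ∀ {x y} → Conn (_∈ ((a , b) ∷ L)) x y → Conn (_∈ L′) (φ x) (φ y)
    contract = EC.gfold (EC.isEquivalence _) φ λ where
      (here refl) → subst (Conn (_∈ L′) (φ a)) φa≡φb ε
      (there p)   → fwd (∈-map⁺ (Prod.map φ φ) p) ◅ ε

    conn′ : ∀ {x y} → x ∈ W′ → y ∈ W′ → ¬ ¬ Conn (_∈ L′) x y
    conn′ x∈ y∈ with ∈-filter⁻ ≢a? {xs = W} x∈ | ∈-filter⁻ ≢a? {xs = W} y∈
    ... | x∈W , x≢a | y∈W , y≢a =
      ¬¬-map (λ w → subst (λ (x , y) → Conn (_∈ L′) x y)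
                          (cong₂ _,_ (φ-fixes x≢a) (φ-fixes y≢a)) (contract w))
             (conn x∈W y∈W)

    length-remove : ∀ W → Unique W → length W ≤ suc (length (filter ≢a? W))
    length-remove [] _ = z≤n
    length-remove (x ∷ W) (x∉W ∷ unique) with x Fin.≟ a
    ... | yes refl = s≤s (ℕ.≤-reflexive (cong length (sym (filter-all ≢a?
                       (All.map (λ a≢y y≡a → a≢y (sym y≡a)) x∉W)))))
    ... | no  _    = s≤s (length-remove W unique)

module _ {A : Set} {P : Pred A 0ℓ} (P? : Decidable P) where

  length-filter-¬ : ∀ xs → length (filter P? xs) + length (filter (¬? ∘ P?) xs) ≡ length xs
  length-filter-¬ [] = refl
  length-filter-¬ (x ∷ xs) with P? x
  ... | yes _ = cong suc (length-filter-¬ xs)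
  ... | no  _ = trans (ℕ.+-suc _ _) (cong suc (length-filter-¬ xs))

  filter-disjoint : ∀ {Q : Pred A 0ℓ} (Q? : Decidable Q) → (∀ {x} → P x → ¬ Q x) →
    ∀ xs → filter P? (filter (¬? ∘ Q?) xs) ≡ filter P? xs
  filter-disjoint Q? disjoint [] = refl
  filter-disjoint Q? disjoint (x ∷ xs) with Q? x
  ... | yes q = trans (filter-disjoint Q? disjoint xs)
                      (sym (filter-reject P? λ p → disjoint p q))
  ... | no  _ with P? x
  ...   | yes _ = cong (x ∷_) (filter-disjoint Q? disjoint xs)
  ...   | no  _ = filter-disjoint Q? disjoint xs

length-filter-classes : ∀ {A : Set} {c} (χ : A → Fin c) {t} (xs : List A) →
  (∀ i → t ≤ length (filter (λ x → χ x Fin.≟ i) xs)) → c * t ≤ length xs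
length-filter-classes {A} {c} χ {t} xs bound =
  go c xs (λ i<c → subst (t ≤_) (cong length (filter-≐ _ _
    (  (λ {x} eq → trans (cong Fin.toℕ eq) (Fin.toℕ-fromℕ< i<c))
    ,  (λ {x} eq → Fin.toℕ-injective (trans eq (sym (Fin.toℕ-fromℕ< i<c))))) xs))
    (bound (Fin.fromℕ< i<c)))
  where
  has : (i : ℕ) (x : A) → Dec (Fin.toℕ (χ x) ≡ i)
  has i x = Fin.toℕ (χ x) ℕ.≟ i

  go : ∀ d xs → (∀ {i} → i < d → t ≤ length (filter (has i) xs)) → d * t ≤ length xs
  go zero    xs bound = z≤n
  go (suc d) xs bound = subst (t + d * t ≤_) (length-filter-¬ (has d) xs)
    (ℕ.+-mono-≤ (bound (ℕ.n<1+n d)) (go d (filter (¬? ∘ has d) xs) λ {i} i<d →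
      subst (t ≤_) (cong length (sym (filter-disjoint (has i) (has d)
          (λ x≡i x≡d → ℕ.<⇒≢ i<d (trans (sym x≡i) x≡d)) xs)))
        (bound (ℕ.m<n⇒m<1+n i<d))))

-- Nash-Williams' theorem by exchanging edges

module _ {v c : ℕ} where

  ColourClass : List (Edge v) → (Edge v → Fin c) → Fin c → EdgeSet v
  ColourClass D χ i f = f ∈ D × χ f ≡ i

  IsForestColouring : List (Edge v) → (Edge v → Fin c) → Set
  IsForestColouring D χ = ∀ i → Acyclic (ColourClass D χ i)

  recolour : (Edge v → Fin c) → Edge v → Fin c → Edge v → Fin c
  recolour χ u i f with f ≟ᴱ u
  ... | yes _ = i
  ... | no  _ = χ f

  recolour⁻ : ∀ χ u i {j f} → recolour χ u i f ≡ j →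
              (f ≢ u × χ f ≡ j) ⊎ (f ≡ u × i ≡ j)
  recolour⁻ χ u i {j} {f} eq with f ≟ᴱ u
  ... | yes f≡u = inj₂ (f≡u , eq)
  ... | no  f≢u = inj₁ (f≢u , eq)

  -- Shared by the exchange step and by the completion of a colouring: classes may shrink freely,
  -- and only colour `i` may gain `u`.
  acyclic-insert : ∀ {P Q : Fin c → EdgeSet v} {u i} →
    (∀ {j} → Q j ⊆ λ g → P j g ⊎ (g ≡ u × i ≡ j)) →
    (∀ j → Acyclic (P j)) → ¬ Joined (P i) u → ∀ j → Acyclic (Q j)
  acyclic-insert {P} {Q} {u} {i} Q⊆ acyclic sep j with i Fin.≟ j
  ... | yes refl = acyclic-⊆ (λ q → old-or-new (Q⊆ q)) (acyclic-∪ (acyclic i) sep)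
    where
    old-or-new : ∀ {g} → P i g ⊎ (g ≡ u × i ≡ i) → (P i ∪ u) g
    old-or-new (inj₁ p)         = inj₁ p
    old-or-new (inj₂ (g≡u , _)) = inj₂ g≡u
  ... | no i≢j = acyclic-⊆ (λ q → old (Q⊆ q)) (acyclic j)
    where
    old : ∀ {g} → P j g ⊎ (g ≡ u × i ≡ j) → P j g
    old (inj₁ p)         = p
    old (inj₂ (_ , i≡j)) = contradiction i≡j i≢j

  module Exchange (D : List (Edge v)) (χ₀ : Edge v → Fin c) (u₀ : Edge v) where

    -- A colouring is a total function, so the uncovered edge also has a colour; deleting it from
    -- every class makes that value meaningless.
    Class : (Edge v → Fin c) → Edge v → Fin c → EdgeSet v
    Class χ u i = ColourClass D χ i ∖ u

    -- Colourings of D minus an uncovered edge u, obtained from (χ₀ , u₀) by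
    -- repeatedly covering u with a colour i at the cost of uncovering an edge
    -- of the cycle this closes.
    data Reach : (Edge v → Fin c) → Edge v → Set where
      start : Reach χ₀ u₀
      step  : ∀ {χ u} → Reach χ u → ∀ {i f} → Separating (Class χ u i) (proj₁ u) (proj₂ u) f →
              Reach (recolour χ u i) f

    Uncoverable : EdgeSet v
    Uncoverable u = ∃ λ χ → Reach χ u

    class-step : ∀ {χ u i f j} → Class (recolour χ u i) f j ⊆ λ g →
                 (Class χ u j ∖ f) g ⊎ (g ≡ u × i ≡ j)
    class-step {χ} {u} {i} ((g∈D , eq) , g≢f) with recolour⁻ χ u i eq
    ... | inj₁ (g≢u , eq′) = inj₁ (((g∈D , eq′) , g≢u) , g≢f)
    ... | inj₂ (g≡u , eq′) = inj₂ (g≡u , eq′)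

    module _ (acyclic₀ : ∀ i → Acyclic (Class χ₀ u₀ i)) where

      -- Uncovering `f` cuts the only path between the ends of `u` in colour `i`, so `u` can take
      -- that colour without closing a cycle.
      reach-acyclic : ∀ {χ u} → Reach χ u → ∀ i → Acyclic (Class χ u i)
      reach-acyclic start = acyclic₀
      reach-acyclic (step r (_ , sep)) =
        acyclic-insert class-step (λ j → acyclic-⊆ proj₁ (reach-acyclic r j)) sep

      module _ (stuck : ¬ ∃ (IsForestColouring D)) where

        -- Otherwise `u` could receive colour `i`, and all of `D` would be coloured.
        reach-joined : ∀ {χ u} → Reach χ u → ∀ i → ¬ ¬ Joined (Class χ u i) u
        reach-joined {χ} {u} r i sep =
          stuck (recolour χ u i , acyclic-insert sub (reach-acyclic r) sep)
          where
          sub : ∀ {j} → ColourClass D (recolour χ u i) j ⊆ λ g →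
                Class χ u j g ⊎ (g ≡ u × i ≡ j)
          sub (g∈D , eq) with recolour⁻ χ u i eq
          ... | inj₁ (g≢u , eq′) = inj₁ ((g∈D , eq′) , g≢u)
          ... | inj₂ new         = inj₂ new

        -- Every edge on the path in class `i` between the ends of `u` is uncovered by one further
        -- exchange.
        reach-uncoverable : ∀ {χ u} → Reach χ u → ∀ i →
                            ¬ ¬ Joined (Class χ u i ∩ Uncoverable) u
        reach-uncoverable r i k = reach-joined r i λ w →
          conn-separating (reach-acyclic r i) w λ w′ →
          k (conn-⊆ (λ { s@(p , _) → p , _ , step r s }) w′)

        -- Exchanges are undone one at a time. An exchange adds to class `j` at most the edge `u`,
        -- and in the preceding colouring the ends of `u` are already joined by uncoverable edges of
        -- that class, so `u` can be replaced in any walk. Connectivity found in different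
        -- colourings is thus transferred to the single colouring `χ₀`.
        conn-start : ∀ {χ u} → Reach χ u → ∀ i {x y} →
          Conn (Class χ u i ∩ Uncoverable) x y →
          ¬ ¬ Conn (Class χ₀ u₀ i ∩ Uncoverable) x y
        conn-start start i w k = k w
        conn-start (step {χ} {u} r {i} {f} s) j =
          EC.fold (¬¬-conn-isEquivalence _) λ where
            (g , unc) → backtrack (class-step {χ} {u} {i} {f} {j} g) unc
          where
          backtrack : ∀ {g} → (Class χ u j ∖ f) g ⊎ (g ≡ u × i ≡ j) → Uncoverable g →
                 ¬ ¬ Joined (Class χ₀ u₀ j ∩ Uncoverable) g
          backtrack (inj₁ (g , _)) unc = conn-start r j (fwd (g , unc) ◅ ε)
          backtrack (inj₂ (refl , refl)) unc k =
            reach-uncoverable r j λ w → conn-start r j w k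

        conn-uncoverable : ∀ i {x y} → Conn Uncoverable x y →
                           ¬ ¬ Conn (Class χ₀ u₀ i ∩ Uncoverable) x y
        conn-uncoverable i = EC.fold (¬¬-conn-isEquivalence _)
          λ { (_ , r) k → reach-uncoverable r i λ w → conn-start r i w k }

  -- A nonempty vertex set is written `w ∷ W`, so that `length W` is its size minus one without
  -- subtraction.
  Sparse : List (Edge v) → Set
  Sparse D = ∀ w W → Unique (w ∷ W) → ∀ es → Unique es →
    (∀ {f} → f ∈ es → f ∈ D × proj₁ f ∈ w ∷ W × proj₂ f ∈ w ∷ W) →
    length es ≤ c * length W

-- Nash-Williams' theorem by the exchange argument in Diestel's book: if colouring
-- D is impossible, then every colour class connects the component S of u₀ in the
-- graph of uncoverable edges, so S spans c (|S| - 1) edges besides u₀.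
sparse⇒forests : ∀ {v c} (D : List (Edge v)) → Unique D → Sparse {c = suc c} D →
  ¬ ¬ ∃ λ (χ : Edge v → Fin (suc c)) → IsForestColouring D χ
sparse⇒forests [] _ _ k = k ((λ _ → zero) , λ _ ())
sparse⇒forests {v} {c} (u₀ ∷ D) unique@(u₀∉D ∷ unique′) sparse stuck =
  sparse⇒forests D unique′
    (λ w W uW es ues sub → sparse w W uW es ues λ f∈ → Prod.map₁ there (sub f∈))
  λ { (χ₀ , forests) → let open Exchange (u₀ ∷ D) χ₀ u₀ in
  -- Membership in the component is decided for all vertices at once, so that its vertices and inner
  -- edges can be listed by `filter`.
  ¬¬-sequence (λ x → ¬¬-excluded-middle {A = Conn Uncoverable (proj₁ u₀) x}) λ S? →
  let
    S = Conn Uncoverable (proj₁ u₀)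
    W = filter S? (allFin v)
    W∋ : ∀ {x} → S x → x ∈ W
    W∋ = ∈-filter⁺ S? (∈-allFin _)
    acyclic₀ : ∀ i → Acyclic (Class χ₀ u₀ i)
    acyclic₀ i = acyclic-⊆ (λ { ((here eq , _) , f≢u₀) → contradiction eq f≢u₀
                              ; ((there f∈D , eq) , _) → f∈D , eq }) (forests i)
    inside? = λ f → S? (proj₁ f) ×-dec S? (proj₂ f)
    inner = filter inside? D
    class = λ i → filter (λ f → χ₀ f Fin.≟ i) inner
    connected : ∀ i {x y} → x ∈ W → y ∈ W → ¬ ¬ Conn (_∈ class i) x y
    connected i x∈W y∈W =
      let Sx = proj₂ (∈-filter⁻ S? {xs = allFin v} x∈W)
          Sy = proj₂ (∈-filter⁻ S? {xs = allFin v} y∈W)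
      in ¬¬-map (conn-within {S = S}
           (λ q Sx → Sx ◅◅ fwd q ◅ ε) (λ q Sy → Sy ◅◅ bwd q ◅ ε)
           (λ { (((here eq , _) , f≢u₀) , _) → contradiction eq f≢u₀
              ; (((there f∈D , eq) , _) , _) Sx Sy →
                ∈-filter⁺ _ (∈-filter⁺ inside? f∈D (Sx , Sy)) eq }) Sx)
         (conn-uncoverable acyclic₀ stuck i (conn-sym Sx ◅◅ Sy))
    uniqueW : Unique W
    uniqueW = Unique.filter⁺ S? (Unique.allFin⁺ v)
    enough : ∀ i → length W ≤ suc (length (class i))
    enough i = length≤1+edges (class i) W uniqueW (connected i)
    uniqueEs : Unique (u₀ ∷ inner)
    uniqueEs = All.tabulate (λ f∈ → All.lookup u₀∉D (proj₁ (∈-filter⁻ inside? {xs = D} f∈)))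
               ∷ Unique.filter⁺ inside? unique′
    within : ∀ {f} → f ∈ u₀ ∷ inner → f ∈ u₀ ∷ D × proj₁ f ∈ W × proj₂ f ∈ W
    within = λ { (here refl) → here refl , W∋ ε , W∋ (fwd (_ , start) ◅ ε)
               ; (there f∈) → let f∈D , Sx , Sy = ∈-filter⁻ inside? {xs = D} f∈ in
                   there f∈D , W∋ Sx , W∋ Sy }
  in overfull χ₀ W (W∋ ε) uniqueW inner enough uniqueEs within }
  where
  overfull : (χ : Edge v → Fin (suc c)) (W : List (Fin v)) → proj₁ u₀ ∈ W → Unique W →
    ∀ inner → (∀ i → length W ≤ suc (length (filter (λ f → χ f Fin.≟ i) inner))) →
    Unique (u₀ ∷ inner) →
    (∀ {f} → f ∈ u₀ ∷ inner → f ∈ u₀ ∷ D × proj₁ f ∈ W × proj₂ f ∈ W) → ⊥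
  overfull χ (w ∷ W) _ uW inner enough ues within = ℕ.n≮n (length inner)
    (ℕ.≤-trans (sparse w W uW (u₀ ∷ inner) ues within)
               (length-filter-classes χ inner (ℕ.≤-pred ∘ enough)))

-- Counting labellings

-- The binomial coefficient k choose 2. The recursion splits off the pairs that contain `zero`, as
-- `pairAt` does.
triangle : ℕ → ℕ
triangle zero    = 0
triangle (suc k) = k + triangle k

2*triangle+k≡k*k : ∀ k → 2 * triangle k + k ≡ k * k
2*triangle+k≡k*k zero    = refl
2*triangle+k≡k*k (suc k) = trans (step k (triangle k))
  (trans (cong (λ t → t + k + k + 1) (2*triangle+k≡k*k k)) (square k))
  where
  step : ∀ k t → 2 * (k + t) + suc k ≡ 2 * t + k + k + k + 1
  step = solve-∀
  square : ∀ k → k * k + k + k + 1 ≡ suc k * suc k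
  square = solve-∀

pairAt : ∀ k → Fin (triangle k) → Fin k × Fin k
pairAt (suc k) t with Fin.splitAt k t
... | inj₁ y  = zero , suc y
... | inj₂ t′ = Prod.map suc suc (pairAt k t′)

pairAt-surjective : ∀ {k} {x y : Fin k} → x Fin.< y → ∃ λ t → pairAt k t ≡ (x , y)
pairAt-surjective {suc k} {zero} {suc y} _ = y Fin.↑ˡ triangle k , eq
  where
  eq : pairAt (suc k) (y Fin.↑ˡ triangle k) ≡ (zero , suc y)
  eq rewrite Fin.splitAt-↑ˡ k y (triangle k) = refl
pairAt-surjective {suc k} {suc x} {suc y} (s≤s x<y)
  with t , at-t ← pairAt-surjective x<y = k Fin.↑ʳ t , eq
  where
  eq : pairAt (suc k) (k Fin.↑ʳ t) ≡ (suc x , suc y)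
  eq rewrite Fin.splitAt-↑ʳ k (triangle k) t = cong (Prod.map suc suc) at-t

funToFin-cong : ∀ {m n} {f g : Fin m → Fin n} → (∀ i → f i ≡ g i) →
                Fin.funToFin f ≡ Fin.funToFin g
funToFin-cong {zero}  eq = refl
funToFin-cong {suc m} eq = cong₂ Fin.combine (eq zero) (funToFin-cong (eq ∘ suc))

finToFun-injective : ∀ {m n} {i j : Fin (n ^ m)} →
  (∀ x → Fin.finToFun {n} {m} i x ≡ Fin.finToFun j x) → i ≡ j
finToFun-injective {m} {n} {i} {j} eq = trans (sym (Fin.funToFin-finToFin {m} {n} i))
  (trans (funToFin-cong {f = Fin.finToFun {n} {m} i} eq) (Fin.funToFin-finToFin {m} {n} j))

lookup-injective : ∀ {A : Set} {xs : List A} → Unique xs →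
                   Injective _≡_ _≡_ (lookup xs)
lookup-injective (_ ∷ _) {zero}  {zero}  _  = refl
lookup-injective (x∉ ∷ _) {zero} {suc j} eq =
  contradiction eq (All.lookup x∉ (∈-lookup j))
lookup-injective (x∉ ∷ _) {suc i} {zero} eq =
  contradiction (sym eq) (All.lookup x∉ (∈-lookup i))
lookup-injective (_ ∷ u) {suc i} {suc j} eq = cong suc (lookup-injective u eq)

^-cancelʳ-≤ : ∀ b → 1 < b → ∀ {i j} → b ^ i ≤ b ^ j → i ≤ j
^-cancelʳ-≤ b 1<b b^i≤b^j =
  ℕ.≮⇒≥ λ j<i → ℕ.<⇒≱ (ℕ.^-monoʳ-< b 1<b j<i) b^i≤b^j

-- Well-ordering without deciding `P`; it supplies the chromatic number of a single labelling.
¬¬-least : ∀ (P : ℕ → Set) {n} → P n → ¬ ¬ ∃ (IsLeast P)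
¬¬-least P {n} Pn k = <-rec (¬_ ∘ P)
  (λ n ih Pn → k (n , Pn , λ j Pj → ℕ.≮⇒≥ λ j<n → ih j<n Pj)) n Pn

-- Read along an ordered pair, an arc type counts twice, once for each direction; hence the base 2n
-- + m.
Fin↔Link : ∀ {n m} → Fin (2 * n + m) ↔ Link n m
Fin↔Link {n} {m} = mk↔ₛ′ to from to-from from-to ↔-∘ ((Fin.*↔× ⊎-↔ ↔-id _) ↔-∘ Fin.+↔⊎)
  where
  to : (Fin 2 × Fin n) ⊎ Fin m → Link n m
  to (inj₁ (zero , i))     = arc⇒ i
  to (inj₁ (suc zero , i)) = arc⇐ i
  to (inj₂ j)              = edge j

  from : Link n m → (Fin 2 × Fin n) ⊎ Fin m
  from (arc⇒ i) = inj₁ (zero , i)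
  from (arc⇐ i) = inj₁ (suc zero , i)
  from (edge j) = inj₂ j

  to-from : ∀ l → to (from l) ≡ l
  to-from (arc⇒ i) = refl
  to-from (arc⇐ i) = refl
  to-from (edge j) = refl

  from-to : ∀ x → from (to x) ≡ x
  from-to (inj₁ (zero , i))     = refl
  from-to (inj₁ (suc zero , i)) = refl
  from-to (inj₂ j)              = refl

reverse-involutive : ∀ {n m} (l : Link n m) → reverse (reverse l) ≡ l
reverse-involutive (arc⇒ i) = refl
reverse-involutive (arc⇐ i) = refl
reverse-involutive (edge j) = refl

reverse-injective : ∀ {n m} {l l′ : Link n m} → reverse l ≡ reverse l′ → l ≡ l′
reverse-injective {l = l} {l′} eq =
  trans (sym (reverse-involutive l)) (trans (cong reverse eq) (reverse-involutive l′))

module _ {n m : ℕ} where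

  pullback : ∀ {s v} → NMGraph n m v → (Fin s → Fin v) → NMGraph n m s
  pullback G f = record
    { link         = λ x y → link G (f x) (f y)
    ; link-reverse = λ x y → link-reverse G (f x) (f y)
    ; link-irrefl  = λ x → link-irrefl G (f x)
    }

  hom-link : ∀ {v w} {G : NMGraph n m v} {H : NMGraph n m w} {f} → IsHom G H f →
    ∀ {x y l} → link G x y ≡ just l → link H (f x) (f y) ≡ just l
  hom-link hom {l = arc⇒ i} eq = IsHom.arc-pres hom i _ _ eq
  hom-link hom {l = edge j} eq = IsHom.edge-pres hom j _ _ eq
  hom-link {G = G} {H} {f} hom {x} {y} {arc⇐ i} eq = trans (link-reverse H (f y) (f x))
    (cong (Maybe.map reverse) (IsHom.arc-pres hom i y x
      (trans (link-reverse G x y) (cong (Maybe.map reverse) eq))))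

  ⟶-refl : ∀ {v} (G : NMGraph n m v) → G ⟶ G
  ⟶-refl G = id , record { arc-pres = λ _ _ _ → id ; edge-pres = λ _ _ _ → id }

  addIsolated : ∀ {v} → NMGraph n m v → NMGraph n m (suc v)
  addIsolated {v} G = record { link = link′ ; link-reverse = rev ; link-irrefl = irrefl }
    where
    link′ : Fin (suc v) → Fin (suc v) → Maybe (Link n m)
    link′ (suc x) (suc y) = link G x y
    link′ _       _       = nothing

    rev : ∀ x y → link′ y x ≡ Maybe.map reverse (link′ x y)
    rev zero    zero    = refl
    rev zero    (suc y) = refl
    rev (suc x) zero    = refl
    rev (suc x) (suc y) = link-reverse G x y

    irrefl : ∀ x → link′ x x ≡ nothing
    irrefl zero    = refl
    irrefl (suc x) = link-irrefl G x

  -- Padding by isolated vertices gives all labellings targets of one common size, as the count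
  -- requires.
  ⟶-enlarge : ∀ {v} {G : NMGraph n m v} {h k} → h ≤′ k →
    Σ (NMGraph n m h) (G ⟶_) → Σ (NMGraph n m k) (G ⟶_)
  ⟶-enlarge ≤′-refl       target = target
  ⟶-enlarge (≤′-step h≤k) target with ⟶-enlarge h≤k target
  ... | H , f , hom = addIsolated H , suc ∘ f , record
    { arc-pres = IsHom.arc-pres hom ; edge-pres = IsHom.edge-pres hom }

  -- Only the labels on pairs x < y matter for `labelled`, so they can be chosen freely, with no
  -- symmetry condition. The diagonal is never adjacent, hence never read.
  orient : ∀ {v} → (Edge v → Link n m) → Fin v → Fin v → Link n m
  orient ℓ x y with x Fin.<? y
  ... | yes _ = ℓ (x , y)
  ... | no  _ = reverse (ℓ (y , x))

  orient-reverse : ∀ {v} (ℓ : Edge v → Link n m) {x y} → x ≢ y →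
                   orient ℓ y x ≡ reverse (orient ℓ x y)
  orient-reverse ℓ {x} {y} x≢y with x Fin.<? y | y Fin.<? x
  ... | yes x<y | yes y<x = contradiction y<x (ℕ.<-asym x<y)
  ... | yes _   | no  _   = refl
  ... | no  _   | yes _   = sym (reverse-involutive _)
  ... | no x≮y  | no y≮x  =
    contradiction (Fin.toℕ-injective (ℕ.≤-antisym (ℕ.≮⇒≥ y≮x) (ℕ.≮⇒≥ x≮y))) x≢y

  orient-< : ∀ {v} (ℓ : Edge v → Link n m) {x y} → x Fin.< y → orient ℓ x y ≡ ℓ (x , y)
  orient-< ℓ {x} {y} x<y with x Fin.<? y
  ... | yes _  = refl
  ... | no x≮y = contradiction x<y x≮y

  labelled : ∀ {v} → SimpleGraph v → (Edge v → Link n m) → NMGraph n m v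
  labelled {v} G ℓ = record
    { link         = λ x y → if adj G x y then just (orient ℓ x y) else nothing
    ; link-reverse = rev
    ; link-irrefl  = λ x → cong (λ a → if a then just (orient ℓ x x) else nothing)
                               (adj-irrefl G x)
    }
    where
    rev : ∀ x y → (if adj G y x then just (orient ℓ y x) else nothing) ≡
      Maybe.map reverse (if adj G x y then just (orient ℓ x y) else nothing)
    rev x y rewrite adj-sym G y x with adj G x y in eq
    ... | false = refl
    ... | true  = cong just (orient-reverse ℓ {x} {y} no-loop)
      where
      no-loop : x ≢ y
      no-loop refl with () ← trans (sym eq) (adj-irrefl G x)

  und-labelled : ∀ {v} (G : SimpleGraph v) ℓ → und (labelled G ℓ) ≐ G
  und-labelled G ℓ x y with adj G x y
  ... | true  = refl
  ... | false = refl

  link-labelled : ∀ {v} (G : SimpleGraph v) ℓ {x y} → Adj G x y → x Fin.< y →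
                  link (labelled G ℓ) x y ≡ just (ℓ (x , y))
  link-labelled G ℓ {x} {y} x~y x<y with adj G x y
  ... | true = cong just (orient-< ℓ x<y)

  -- A labelling is determined by the vertex map q and the links of H between the
  -- pairs x < y; a missing link of H is encoded as default.
  labellings-bound : ∀ {N h e} {S : Set} (vertex : Fin N → S → Fin h) (ends : Fin e → S × S) →
    Link n m →
    (∀ (ℓ : Fin e → Link n m) → ¬ ¬ ∃ λ q → Σ (NMGraph n m h) λ H → ∀ j →
      link H (vertex q (proj₁ (ends j))) (vertex q (proj₂ (ends j))) ≡ just (ℓ j)) →
    (2 * n + m) ^ e ≤ N * (2 * n + m) ^ triangle h
  labellings-bound {N} {h} {e} {S} vertex ends default realize =
    decidable-stable (_ ℕ.≤? _) λ k →
    -- Labellings are indexed by the finite type `Fin (b ^ e)`, so the doubly negated realizations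
    -- combine into one choice function `R`.
    ¬¬-sequence (λ w → realize (labelling w)) λ R →
      k (Fin.injective⇒≤ {f = encode R} (encode-injective R))
    where
    b = 2 * n + m
    open Inverse (Fin↔Link {n} {m}) renaming (to to toLink; from to fromLink)

    toLink-injective : ∀ {i j} → toLink i ≡ toLink j → i ≡ j
    toLink-injective {i} {j} eq =
      trans (sym (strictlyInverseʳ i)) (trans (cong fromLink eq) (strictlyInverseʳ j))

    fromLink-injective : ∀ {i j} → fromLink i ≡ fromLink j → i ≡ j
    fromLink-injective {i} {j} eq =
      trans (sym (strictlyInverseˡ i)) (trans (cong toLink eq) (strictlyInverseˡ j))

    labelling : Fin (b ^ e) → Fin e → Link n m
    labelling w j = toLink (Fin.finToFun w j)

    Realized : (Fin e → Link n m) → Set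
    Realized ℓ = ∃ λ q → Σ (NMGraph n m h) λ H → ∀ j →
      link H (vertex q (proj₁ (ends j))) (vertex q (proj₂ (ends j))) ≡ just (ℓ j)

    codes : NMGraph n m h → Fin (triangle h) → Fin b
    codes H t = fromLink (fromMaybe default (uncurry (link H) (pairAt h t)))

    encode : (∀ w → Realized (labelling w)) → Fin (b ^ e) → Fin (N * b ^ triangle h)
    encode R w with q , H , _ ← R w = Fin.combine q (Fin.funToFin (codes H))

    read-code : ∀ (H : NMGraph n m h) {t x y l} → pairAt h t ≡ (x , y) →
      link H x y ≡ just l → fromMaybe default (uncurry (link H) (pairAt h t)) ≡ l
    read-code H at-t xy =
      cong (fromMaybe default) (trans (cong (uncurry (link H)) at-t) xy)

    module _ {H H′ : NMGraph n m h} (eq : ∀ t → codes H t ≡ codes H′ t) where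

      link-determined-< : ∀ {x y l l′} → x Fin.< y →
        link H x y ≡ just l → link H′ x y ≡ just l′ → l ≡ l′
      link-determined-< x<y xy xy′ with t , at-t ← pairAt-surjective x<y =
        trans (sym (read-code H at-t xy))
              (trans (fromLink-injective (eq t)) (read-code H′ at-t xy′))

      link-determined : ∀ {x y l l′} →
        link H x y ≡ just l → link H′ x y ≡ just l′ → l ≡ l′
      link-determined {x} {y} xy xy′ with Fin.<-cmp x y
      ... | tri< x<y _ _ = link-determined-< x<y xy xy′
      ... | tri≈ _ refl _ with () ← trans (sym xy) (link-irrefl H x)
      ... | tri> _ _ y<x = reverse-injective (link-determined-< y<x
              (trans (link-reverse H x y) (cong (Maybe.map reverse) xy))
              (trans (link-reverse H′ x y) (cong (Maybe.map reverse) xy′)))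

    encode-injective : ∀ R → Injective _≡_ _≡_ (encode R)
    encode-injective R {w} {w′} eq with R w | R w′
    ... | q , H , ok | q′ , H′ , ok′
      with Fin.combine-injective q (Fin.funToFin (codes H)) q′ (Fin.funToFin (codes H′)) eq
    ... | refl , same = finToFun-injective {e} λ j → toLink-injective
      (link-determined {H} {H′} codes-≡ (ok j) (ok′ j))
      where
      codes-≡ : ∀ t → codes H t ≡ codes H′ t
      codes-≡ t = trans (sym (Fin.finToFun-funToFin (codes H) t))
        (trans (cong (λ z → Fin.finToFun z t) same) (Fin.finToFun-funToFin (codes H′) t))

  -- The maximum `k` bounds the chromatic number of `G′` once that number is known to exist, which
  -- `¬¬-least` gives only under a double negation.
  ¬¬-hom-to-k : ∀ {v} {G : SimpleGraph v} {k} → IsSimpleChromaticNumber n m G k →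
    ∀ (G′ : NMGraph n m v) → und G′ ≐ G → ¬ ¬ Σ (NMGraph n m k) (G′ ⟶_)
  ¬¬-hom-to-k (_ , greatest) G′ und≐ =
    ¬¬-map (λ { (j , least) →
        ⟶-enlarge (ℕ.≤⇒≤′ (greatest j (G′ , und≐ , least))) (proj₁ least) })
      (¬¬-least (λ h → Σ (NMGraph n m h) (G′ ⟶_)) (G′ , ⟶-refl G′))

  module _ {v} (G : SimpleGraph v) (W : List (Fin v)) (es : List (Edge v))
    (unique : Unique es)
    (within : ∀ {f} → f ∈ es → (proj₁ f Fin.< proj₂ f × Adj G (proj₁ f) (proj₂ f)) ×
                               (proj₁ f ∈ W × proj₂ f ∈ W))
    (default : Link n m) where

    private
      open DecMembership (_≟ᴱ_ {v}) using (_∈?_)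

      -- The chromatic number concerns all of `G`, so a labelling of `es` must be completed on the
      -- other edges; any fixed label will do there.
      extend : (Fin (length es) → Link n m) → Edge v → Link n m
      extend ℓ f with f ∈? es
      ... | yes f∈es = ℓ (index f∈es)
      ... | no  _    = default

      extend-lookup : ∀ ℓ j → extend ℓ (lookup es j) ≡ ℓ j
      extend-lookup ℓ j with lookup es j ∈? es
      ... | yes f∈es = cong ℓ (lookup-injective unique (sym (lookup-index f∈es)))
      ... | no  f∉es = contradiction (∈-lookup j) f∉es

      -- Ends are positions in `W`, so only the restriction of a homomorphism to `W` is counted.
      ends : Fin (length es) → Fin (length W) × Fin (length W)
      ends j with _ , x∈W , y∈W ← within (∈-lookup {xs = es} j) = index x∈W , index y∈W

      link-ends : ∀ ℓ j → link (labelled G (extend ℓ)) (lookup W (proj₁ (ends j)))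
                                 (lookup W (proj₂ (ends j))) ≡ just (ℓ j)
      link-ends ℓ j with (x<y , x~y) , x∈W , y∈W ← within (∈-lookup {xs = es} j)
        rewrite sym (lookup-index x∈W) | sym (lookup-index y∈W) =
        trans (link-labelled G (extend ℓ) x~y x<y) (cong just (extend-lookup ℓ j))

    -- The labelled graph, pulled back to `W`, serves as its own target under the identity, the one
    -- vertex map. The same count then yields the trivial bound by the number of pairs in `W`.
    edges-bound-self : (2 * n + m) ^ length es ≤ 1 * (2 * n + m) ^ triangle (length W)
    edges-bound-self = labellings-bound {N = 1} (λ _ → id) ends default λ ℓ k →
      k (zero , pullback (labelled G (extend ℓ)) (lookup W) , link-ends ℓ)

    edges-bound : ∀ {k} → IsSimpleChromaticNumber n m G k →
      (2 * n + m) ^ length es ≤ k ^ length W * (2 * n + m) ^ triangle k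
    edges-bound χ≡k = labellings-bound Fin.finToFun ends default λ ℓ →
      ¬¬-map (λ { (H , f , hom) → Fin.funToFin (f ∘ lookup W) , H , λ j →
        trans (cong₂ (link H) (Fin.finToFun-funToFin (f ∘ lookup W) (proj₁ (ends j)))
                              (Fin.finToFun-funToFin (f ∘ lookup W) (proj₂ (ends j))))
              (hom-link hom (link-ends ℓ j)) })
        (¬¬-hom-to-k {G = G} χ≡k (labelled G (extend ℓ)) (und-labelled G (extend ℓ)))

-- From colourings to forest decompositions

-- All steps of a cycle differ from its closing edge, so together they join the ends of that edge
-- without it.
acyclic⇒forest : ∀ {v} {P : EdgeSet v} (G : SimpleGraph v) → Acyclic P →
  (∀ {x y} → Adj G x y → P (x , y) ⊎ P (y , x)) → IsForest G
acyclic⇒forest {v} {P} G acyclic Adj⇒P ℓ c cycle =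
  let f , Pf , f-closes = joining (Adj⇒P close)
  in acyclic-joins acyclic Pf f-closes (conn-sym (path f-closes (Fin.fromℕ (2 + ℓ))))
  where
  open IsCycle cycle

  joining : ∀ {x y} → P (x , y) ⊎ P (y , x) → ∃ λ f → P f × Joins f x y
  joining (inj₁ p) = _ , p , inj₁ refl
  joining (inj₂ p) = _ , p , inj₂ refl

  same-ends : ∀ {f} {x y x′ y′ : Fin v} → Joins f x y → Joins f x′ y′ →
              (x ≡ x′ × y ≡ y′) ⊎ (x ≡ y′ × y ≡ x′)
  same-ends (inj₁ refl) (inj₁ refl) = inj₁ (refl , refl)
  same-ends (inj₁ refl) (inj₂ refl) = inj₂ (refl , refl)
  same-ends (inj₂ refl) (inj₁ refl) = inj₂ (refl , refl)
  same-ends (inj₂ refl) (inj₂ refl) = inj₁ (refl , refl)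

  step≢close : ∀ {f} i → Joins f (c (Fin.inject₁ i)) (c (suc i)) →
               ¬ Joins f (c (Fin.fromℕ (2 + ℓ))) (c zero)
  step≢close i j j′ with same-ends j j′
  ... | inj₁ (eq , _) = Fin.fromℕ≢inject₁ (sym (distinct eq))
  ... | inj₂ (eq , eq′) with i | distinct eq | distinct eq′
  -- A step equal to the reversed closing edge would make the last vertex the one of index 1, but
  -- its index is at least 2.
  ...   | zero | _ | ()

  path : ∀ {f} → Joins f (c (Fin.fromℕ (2 + ℓ))) (c zero) →
         ∀ i → Conn (P ∖ f) (c zero) (c i)
  path {f} f-closes = <-weakInduction (λ i → Conn (P ∖ f) (c zero) (c i)) ε λ i w →
    let g , Pg , j = joining (Adj⇒P (step i))
    in w ◅◅ conn-edge (Pg , λ { refl → step≢close i j f-closes }) j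

does⁻ : ∀ {A : Set} (a? : Dec A) → T (does a?) → A
does⁻ (yes a) _ = a

does⁺ : ∀ {A : Set} (a? : Dec A) → A → T (does a?)
does⁺ (yes _) _ = _
does⁺ (no ¬a) a = contradiction a ¬a

module _ {v : ℕ} (G : SimpleGraph v) where

  IsEdge : EdgeSet v
  IsEdge (x , y) = x Fin.< y × Adj G x y

  isEdge? : Decidable IsEdge
  isEdge? (x , y) = (x Fin.<? y) ×-dec T? (adj G x y)

  edges : List (Edge v)
  edges = filter isEdge? (cartesianProduct (allFin v) (allFin v))

  edges⁻ : ∀ {f} → f ∈ edges → IsEdge f
  edges⁻ f∈ = proj₂ (∈-filter⁻ isEdge? {xs = cartesianProduct (allFin v) (allFin v)} f∈)

  edges⁺ : ∀ {f} → IsEdge f → f ∈ edges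
  edges⁺ = ∈-filter⁺ isEdge? (∈-cartesianProduct⁺ (∈-allFin _) (∈-allFin _))

  edges-unique : Unique edges
  edges-unique = Unique.filter⁺ isEdge?
    (Unique.cartesianProduct⁺ (Unique.allFin⁺ v) (Unique.allFin⁺ v))

  forestDecomposition : ∀ {c} (χ : Edge v → Fin c) → IsForestColouring edges χ →
    Σ (Fin c → SimpleGraph v) λ F → IsForestDecomposition G c F
  forestDecomposition {c} χ forest = F , record
    { forests   = λ i → acyclic⇒forest (F i) (forest i) (λ {x} {y} → F⁻ i x y)
    ; subgraphs = λ i x y → class⇒adj i x y ∘ F⁻ i x y
    ; partition = λ x y x~y → colour x y x~y
    }
    where
    open DecMembership (_≟ᴱ_ {v}) using (_∈?_)

    class? : ∀ i → Decidable (ColourClass edges χ i)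
    class? i f = (f ∈? edges) ×-dec (χ f Fin.≟ i)

    ends? : ∀ i x y → Dec (ColourClass edges χ i (x , y) ⊎ ColourClass edges χ i (y , x))
    ends? i x y = class? i (x , y) ⊎-dec class? i (y , x)

    F : Fin c → SimpleGraph v
    F i = record
      { adj        = λ x y → does (ends? i x y)
      ; adj-sym    = λ x y → ∨-comm (does (class? i (x , y))) _
      ; adj-irrefl = λ x → dec-false (ends? i x x)
          λ { (inj₁ (p , _)) → ℕ.n≮n _ (proj₁ (edges⁻ p))
            ; (inj₂ (p , _)) → ℕ.n≮n _ (proj₁ (edges⁻ p)) }
      }

    F⁻ : ∀ i x y → Adj (F i) x y → ColourClass edges χ i (x , y) ⊎ ColourClass edges χ i (y , x)
    F⁻ i x y = does⁻ (ends? i x y)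

    class⇒adj : ∀ i x y → ColourClass edges χ i (x , y) ⊎ ColourClass edges χ i (y , x) →
                Adj G x y
    class⇒adj i x y (inj₁ (p , _)) = proj₂ (edges⁻ p)
    class⇒adj i x y (inj₂ (p , _)) = subst T (adj-sym G y x) (proj₂ (edges⁻ p))

    colour-unique : ∀ {x y i} → (x , y) ∈ edges →
      ColourClass edges χ i (x , y) ⊎ ColourClass edges χ i (y , x) → χ (x , y) ≡ i
    colour-unique p (inj₁ (_ , eq)) = eq
    colour-unique p (inj₂ (q , _))  =
      contradiction (proj₁ (edges⁻ q)) (ℕ.<-asym (proj₁ (edges⁻ p)))

    colour : ∀ x y → Adj G x y → ∃! _≡_ λ i → Adj (F i) x y
    colour x y x~y with Fin.<-cmp x y
    ... | tri< x<y _ _ = let p = edges⁺ (x<y , x~y) in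
      χ (x , y) , does⁺ (ends? _ x y) (inj₁ (p , refl)) ,
      λ {i} q → colour-unique p (F⁻ i x y q)
    ... | tri≈ _ refl _ with () ← subst T (adj-irrefl G x) x~y
    ... | tri> _ _ y<x = let p = edges⁺ (y<x , subst T (adj-sym G x y) x~y) in
      χ (y , x) , does⁺ (ends? _ x y) (inj₂ (p , refl)) ,
      λ {i} q → colour-unique p (Sum.swap (F⁻ i x y q))

-- For |W| = s + 1 ≤ 2c the trivial bound |E(W)| ≤ s (s + 1) / 2 suffices; for larger
-- W the labelling count gives 2 |E(W)| ≤ k (k - 1) + d (s + 1), where d = 2c - k.
span-bound : ∀ {b c d k e s} → 1 < b → 1 ≤ k → k + d ≡ c * 2 → k ^ 2 ≤ b ^ d →
  b ^ e ≤ 1 * b ^ triangle (suc s) → b ^ e ≤ k ^ suc s * b ^ triangle k → e ≤ c * s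
span-bound {b} {c} {d} {k} {e} {s} 1<b 1≤k k+d≡2c k²≤bᵈ self hom
  with suc s ℕ.≤? c * 2
... | yes s<2c = ℕ.*-cancelˡ-≤ 2 (begin
  2 * e                ≤⟨ ℕ.*-monoʳ-≤ 2 (^-cancelʳ-≤ b 1<b {e} {triangle (suc s)}
                            (subst (b ^ e ≤_) (ℕ.*-identityˡ _) self)) ⟩
  2 * triangle (suc s) ≡⟨ ℕ.+-cancelʳ-≡ (suc s) _ _
                            (trans (2*triangle+k≡k*k (suc s)) (square s)) ⟩
  suc s * s            ≤⟨ ℕ.*-monoˡ-≤ s s<2c ⟩
  c * 2 * s            ≡⟨ swap c s ⟩
  2 * (c * s)          ∎)
  where
  open ℕ.≤-Reasoning
  square : ∀ s → suc s * suc s ≡ suc s * s + suc s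
  square = solve-∀
  swap : ∀ c s → c * 2 * s ≡ 2 * (c * s)
  swap = solve-∀
... | no  s≮2c = ℕ.*-cancelˡ-≤ 2 (begin
  2 * e                        ≡⟨ ℕ.*-comm 2 e ⟩
  e * 2                        ≤⟨ ^-cancelʳ-≤ b 1<b powers ⟩
  d * suc s + triangle k * 2   ≡⟨ regroup d s (triangle k) ⟩
  -- The surplus is enlarged to k(k + d) = 2ck, using k ≥ 1; the bound 2c ≤ s then absorbs it into
  -- `k * s`.
  d * s + (d + 2 * triangle k) ≤⟨ ℕ.+-monoʳ-≤ (d * s) (ℕ.+-mono-≤ d≤kd 2T≤kk) ⟩
  d * s + (k * d + k * k)      ≡⟨ factor d s k ⟩
  d * s + k * (k + d)          ≤⟨ ℕ.+-monoʳ-≤ (d * s) (ℕ.*-monoʳ-≤ k k+d≤s) ⟩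
  d * s + k * s                ≡⟨ collect d s k ⟩
  (k + d) * s                  ≡⟨ cong (_* s) k+d≡2c ⟩
  c * 2 * s                    ≡⟨ swap c s ⟩
  2 * (c * s)                  ∎)
  where
  open ℕ.≤-Reasoning
  t = triangle k
  square : ∀ x y → x * y * (x * y * 1) ≡ x * (x * 1) * (y * (y * 1))
  square = solve-∀
  swap : ∀ c s → c * 2 * s ≡ 2 * (c * s)
  swap = solve-∀
  regroup : ∀ d s t → d * suc s + t * 2 ≡ d * s + (d + 2 * t)
  regroup = solve-∀
  factor : ∀ d s k → d * s + (k * d + k * k) ≡ d * s + k * (k + d)
  factor = solve-∀
  collect : ∀ d s k → d * s + k * s ≡ (k + d) * s
  collect = solve-∀
  d≤kd : d ≤ k * d
  d≤kd = ℕ.m≤n*m d k {{ℕ.>-nonZero 1≤k}}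
  2T≤kk : 2 * triangle k ≤ k * k
  2T≤kk = subst (2 * triangle k ≤_) (2*triangle+k≡k*k k) (ℕ.m≤m+n _ k)
  k+d≤s : k + d ≤ s
  k+d≤s = subst (_≤ s) (sym k+d≡2c) (ℕ.≤-pred (ℕ.≰⇒> s≮2c))
  -- Squaring clears the halves: the hypothesis `k²≤bᵈ`, that is 2 log_b k ≤ d, bounds `k ^ 2` and
  -- not `k` itself.
  powers : b ^ (e * 2) ≤ b ^ (d * suc s + triangle k * 2)
  powers = begin
    b ^ (e * 2)                         ≡⟨ ℕ.^-*-assoc b e 2 ⟨
    (b ^ e) ^ 2                         ≤⟨ ℕ.^-monoˡ-≤ 2 hom ⟩
    (k ^ suc s * b ^ t) ^ 2             ≡⟨ square (k ^ suc s) (b ^ t) ⟩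
    (k ^ suc s) ^ 2 * (b ^ t) ^ 2       ≡⟨ cong₂ _*_ (ℕ.^-*-assoc k (suc s) 2)
                                                     (ℕ.^-*-assoc b t 2) ⟩
    k ^ (suc s * 2) * b ^ (t * 2)       ≡⟨ cong (λ x → k ^ x * b ^ (t * 2))
                                                (ℕ.*-comm (suc s) 2) ⟩
    k ^ (2 * suc s) * b ^ (t * 2)       ≡⟨ cong (_* b ^ (t * 2)) (ℕ.^-*-assoc k 2 (suc s)) ⟨
    (k ^ 2) ^ suc s * b ^ (t * 2)       ≤⟨ ℕ.*-monoˡ-≤ (b ^ (t * 2))
                                             (ℕ.^-monoˡ-≤ (suc s) k²≤bᵈ) ⟩
    (b ^ d) ^ suc s * b ^ (t * 2)       ≡⟨ cong (_* b ^ (t * 2)) (ℕ.^-*-assoc b d (suc s)) ⟩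
    b ^ (d * suc s) * b ^ (t * 2)       ≡⟨ ℕ.^-distribˡ-+-* b (d * suc s) (t * 2) ⟨
    b ^ (d * suc s + t * 2)             ∎

-- The ceiling and the conclusion

log-zero : ∀ b q → log b 0 q
log-zero b (ℚᵘ.mkℚᵘ (+ a)    d) = z≤n
log-zero b (ℚᵘ.mkℚᵘ -[1+ a ] d) = z≤n

-- The fraction c - k/2 is computed with denominator 2 and numerator 2c - k, so the bound reads
-- `k ^ 2 ≤ b ^ d` with d = 2c - k. A negative numerator would give log_b k < 0, impossible for k ≥
-- 1.
log-bound : ∀ {b k c} → 1 < b → 1 ≤ k → (log b k ⊕ (+ k ℚᵘ./ 2)) (c ℚᵘ./ 1) →
  ∃ λ c′ → c ≡ + c′ × ∃ λ d → k + d ≡ c′ * 2 × k ^ 2 ≤ b ^ d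
log-bound {b} {k} {c} 1<b 1≤k bound = cases (c ℤ.* + 2 ℤ.+ ℤ.- (+ k) ℤ.* + 1) refl bound
  where
  add-back : ∀ c k → c ℤ.* + 2 ℤ.+ ℤ.- k ℤ.* + 1 ℤ.+ k ≡ c ℤ.* + 2
  add-back = ℤ.solve-∀

  halve : ∀ {a} c → + (a + k) ≡ c ℤ.* + 2 → k ^ 2 ≤ b ^ a →
    ∃ λ c′ → c ≡ + c′ × ∃ λ d → k + d ≡ c′ * 2 × k ^ 2 ≤ b ^ d
  halve {a} (+ c′) eq k²≤ = c′ , refl , a , trans (ℕ.+-comm k a)
    (ℤ.+-injective (trans eq (sym (ℤ.pos-* c′ 2)))) , k²≤
  halve -[1+ _ ] ()

  cases : ∀ N → N ≡ c ℤ.* + 2 ℤ.+ ℤ.- (+ k) ℤ.* + 1 → log b k (ℚᵘ.mkℚᵘ N 1) →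
    ∃ λ c′ → c ≡ + c′ × ∃ λ d → k + d ≡ c′ * 2 × k ^ 2 ≤ b ^ d
  cases (+ a) eq k²≤ = halve c (trans (cong (ℤ._+ + k) eq) (add-back c (+ k))) k²≤
  cases -[1+ a ] eq k²bᵃ≤1 = contradiction
    (ℕ.≤-trans (ℕ.*-mono-≤ (ℕ.^-monoˡ-≤ 2 1≤k)
                           (ℕ.^-monoʳ-< b 1<b {0} {suc a} (s≤s z≤n))) k²bᵃ≤1)
    λ { (s≤s ()) }

1<2n+m : ∀ n m → 1 ≤ 2 * n + m → (n , m) ≢ (0 , 1) → 1 < 2 * n + m
1<2n+m zero    (suc zero)    _ ≢01 = contradiction refl ≢01
1<2n+m zero    (suc (suc m)) _ _   = s≤s (s≤s z≤n)
1<2n+m (suc n) m             _ _   =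
  s≤s (ℕ.≤-trans (s≤s z≤n) (ℕ.≤-reflexive (cong (_+ m) (sym (ℕ.+-suc n (n + 0))))))

theorem2p2 : (n m : ℕ) → 1 ≤ 2 * n + m → (n , m) ≢ (0 , 1) →
    ∀ {v} (G : SimpleGraph v) (k r : ℕ) (c : ℤ) →
    IsSimpleChromaticNumber n m G k →
    IsArboricity G r →
    IsCeiling (log (2 * n + m) k ⊕ (+ k ℚᵘ./ 2)) c →
    + r ℤ.≤ c
-- For k = 0 the logarithm is -∞: the predecessor of `c` is an upper bound too, so no ceiling
-- exists.
theorem2p2 n m _ _ G zero r c _ _ (_ , least) =
  contradiction (least (ℤ.pred c) (log-zero (2 * n + m) (ℤ.pred c ℚᵘ./ 1 ℚᵘ.- (+ 0 ℚᵘ./ 2))))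
    (ℤ.<⇒≱ (ℤ.i≤pred[j]⇒i<j ℤ.≤-refl))
theorem2p2 n m 1≤b ≢01 {v} G k@(suc _) r c χ≡k (_ , least) (bound , _)
  with log-bound {c = c} (1<2n+m n m 1≤b ≢01) (s≤s z≤n) bound
-- The case c = 0 is excluded by k + d = 2c with k ≥ 1, so there is at least one colour.
... | suc c′ , refl , d , k+d≡2c , k²≤bᵈ = ℤ.+≤+ (decidable-stable (r ℕ.≤? suc c′) λ r≰c →
  sparse⇒forests (edges G) (edges-unique G) sparse λ { (χ , forest) →
    r≰c (least (suc c′) (forestDecomposition G χ forest)) })
  where
  someLink : Link n m
  someLink = Inverse.to Fin↔Link (Fin.fromℕ< 1≤b)

  sparse : Sparse {c = suc c′} (edges G)
  sparse w W _ es unique within =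
    span-bound {c = suc c′} {d} {k} {s = length W} (1<2n+m n m 1≤b ≢01) (s≤s z≤n) k+d≡2c k²≤bᵈ
      (edges-bound-self G (w ∷ W) es unique edges-within someLink)
      (edges-bound G (w ∷ W) es unique edges-within someLink χ≡k)
    where
    edges-within : ∀ {f} → f ∈ es → IsEdge G f × (proj₁ f ∈ w ∷ W × proj₂ f ∈ w ∷ W)
    edges-within f∈es = Prod.map₁ (edges⁻ G) (within f∈es)
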